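{- Let $\tau \geq 1$ be a real number. Then $\tau$ is the largest element of $\mathcal{C}(\mathcal{S}_\tau)$; that is, $\tau \in \mathcal{C}(\mathcal{S}_\tau)$, and every $t \in \mathcal{C}(\mathcal{S}_\tau)$ satisfies $t \leq \tau$.
   Context: $\mathbb{N} = \{0,1,2,\dots\}$. For a real number $t>0$, the lattice associated to $t$ is $\mathcal{S}_t = \{ \lfloor t k \rfloor : k \in \mathbb{N} \}$. For a set $A \subset \mathbb{N}$, a positive real number $t$ is compatible with $A$ if $A \subset \mathcal{S}_t$, and $\mathcal{C}(A) = \{ t > 0 : A \subset \mathcal{S}_t \}$ is the set of values compatible with $A$. -}

module Defs where

open import Data.Integer as ℤ using (ℤ; +_; 1ℤ)
open import Data.Nat as ℕ using (ℕ; _⊔_)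
import Data.Nat.Properties as ℕ
open import Data.Product using (∃-syntax; _×_; _,_; proj₁; proj₂)
open import Data.Rational as ℚ using (ℚ; 0ℚ; 1ℚ; _+_; _*_; _-_; ∣_∣; 1/_; Positive; NonZero; positive)
open import Data.Rational.Properties as ℚ using (module ≤-Reasoning)
open import Data.Rational.Solver using (module +-*-Solver)
open import Level using (0ℓ)
open import Relation.Binary.PropositionalEquality using (_≡_; refl; sym; trans; cong; subst)
open import Relation.Nullary using (¬_)
open import Relation.Unary using (Pred; _⊆_)

IsCauchy : (ℕ → ℚ) → Set
IsCauchy x = ∀ ε → 0ℚ ℚ.< ε →
  ∃[ N ] (∀ m n → N ℕ.≤ m → N ℕ.≤ n → ∣ x m - x n ∣ ℚ.< ε)

EventuallyBounded : (ℕ → ℚ) → Set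
EventuallyBounded x = ∃[ B ] ∃[ N ] (0ℚ ℚ.< B × (∀ n → N ℕ.≤ n → ∣ x n ∣ ℚ.≤ B))

isCauchy⇒bounded : ∀ x → IsCauchy x → EventuallyBounded x
isCauchy⇒bounded x cx with cx 1ℚ (ℚ.positive⁻¹ 1ℚ)
... | N , close = 1ℚ + ∣ x N ∣ , N , 0<B , bound
  where
  open ≤-Reasoning
  0<B : 0ℚ ℚ.< 1ℚ + ∣ x N ∣
  0<B = ℚ.+-mono-<-≤ {0ℚ} {1ℚ} {0ℚ} (ℚ.positive⁻¹ 1ℚ) (ℚ.0≤∣p∣ (x N))

  split : ∀ p q → p ≡ (p - q) + q
  split = solve 2 (λ p q → p := (p :- q) :+ q) refl
    where open +-*-Solver

  bound : ∀ n → N ℕ.≤ n → ∣ x n ∣ ℚ.≤ 1ℚ + ∣ x N ∣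
  bound n N≤n = begin
    ∣ x n ∣                      ≡⟨ cong ∣_∣ (split (x n) (x N)) ⟩
    ∣ (x n - x N) + x N ∣        ≤⟨ ℚ.∣p+q∣≤∣p∣+∣q∣ (x n - x N) (x N) ⟩
    ∣ x n - x N ∣ + ∣ x N ∣      ≤⟨ ℚ.+-monoˡ-≤ ∣ x N ∣ (ℚ.<⇒≤ (close n N N≤n ℕ.≤-refl)) ⟩
    1ℚ + ∣ x N ∣                 ∎

isCauchy-const : ∀ q → IsCauchy (λ _ → q)
isCauchy-const q ε 0<ε = 0 , λ _ _ _ _ → subst (λ r → ∣ r ∣ ℚ.< ε) (sym (ℚ.+-inverseʳ q)) 0<ε

isCauchy-* : ∀ x y → IsCauchy x → IsCauchy y → IsCauchy (λ n → x n * y n)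
isCauchy-* x y cx cy ε 0<ε = N , close
  where
  open ≤-Reasoning
  bx = isCauchy⇒bounded x cx
  by = isCauchy⇒bounded y cy

  Bx By B : ℚ
  Bx = proj₁ bx
  By = proj₁ by
  B  = Bx + By

  0<Bx : 0ℚ ℚ.< Bx
  0<Bx = proj₁ (proj₂ (proj₂ bx))
  0<By : 0ℚ ℚ.< By
  0<By = proj₁ (proj₂ (proj₂ by))
  Bx≤B : Bx ℚ.≤ B
  Bx≤B = subst (ℚ._≤ B) (ℚ.+-identityʳ Bx) (ℚ.+-monoʳ-≤ Bx (ℚ.<⇒≤ 0<By))
  By≤B : By ℚ.≤ B
  By≤B = subst (ℚ._≤ B) (ℚ.+-identityˡ By) (ℚ.+-monoˡ-≤ By (ℚ.<⇒≤ 0<Bx))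

  instance
    B⁺ : Positive B
    B⁺ = positive (ℚ.+-mono-< {0ℚ} {Bx} {0ℚ} 0<Bx 0<By)
    B+B⁺ : Positive (B + B)
    B+B⁺ = ℚ.pos+pos⇒pos B B
    B+B≢0 : NonZero (B + B)
    B+B≢0 = ℚ.pos⇒nonZero (B + B)
    ε⁺ : Positive ε
    ε⁺ = positive 0<ε

  δ : ℚ
  δ = ε * 1/ (B + B)
  0<δ : 0ℚ ℚ.< δ
  0<δ = ℚ.positive⁻¹ δ {{ℚ.pos*pos⇒pos ε (1/ (B + B)) {{ℚ.1/pos⇒pos (B + B)}}}}

  δB+Bδ≡ε : δ * B + B * δ ≡ ε
  δB+Bδ≡ε = trans (regroup ε (1/ (B + B)) B)
    (trans (cong (ε *_) (ℚ.*-inverseˡ (B + B))) (ℚ.*-identityʳ ε))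
    where
    open +-*-Solver
    regroup : ∀ e i b → (e * i) * b + b * (e * i) ≡ e * (i * (b + b))
    regroup = solve 3 (λ e i b → (e :* i) :* b :+ b :* (e :* i) := e :* (i :* (b :+ b))) refl

  Nx Ny Mx My N : ℕ
  Nx = proj₁ (proj₂ bx)
  Ny = proj₁ (proj₂ by)
  Mx = proj₁ (cx δ 0<δ)
  My = proj₁ (cy δ 0<δ)
  N  = (Nx ⊔ Ny) ⊔ (Mx ⊔ My)

  split : ∀ a b c d → a * b - c * d ≡ (a - c) * b + c * (b - d)
  split = solve 4 (λ a b c d → a :* b :- c :* d := (a :- c) :* b :+ c :* (b :- d)) refl
    where open +-*-Solver

  close : ∀ m n → N ℕ.≤ m → N ℕ.≤ n → ∣ x m * y m - x n * y n ∣ ℚ.< ε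
  close m n N≤m N≤n = begin-strict
    ∣ x m * y m - x n * y n ∣
      ≡⟨ cong ∣_∣ (split (x m) (y m) (x n) (y n)) ⟩
    ∣ (x m - x n) * y m + x n * (y m - y n) ∣
      ≤⟨ ℚ.∣p+q∣≤∣p∣+∣q∣ ((x m - x n) * y m) (x n * (y m - y n)) ⟩
    ∣ (x m - x n) * y m ∣ + ∣ x n * (y m - y n) ∣
      ≡⟨ cong (_+ ∣ x n * (y m - y n) ∣) (ℚ.∣p*q∣≡∣p∣*∣q∣ (x m - x n) (y m)) ⟩
    ∣ x m - x n ∣ * ∣ y m ∣ + ∣ x n * (y m - y n) ∣
      ≡⟨ cong (λ r → ∣ x m - x n ∣ * ∣ y m ∣ + r) (ℚ.∣p*q∣≡∣p∣*∣q∣ (x n) (y m - y n)) ⟩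
    ∣ x m - x n ∣ * ∣ y m ∣ + ∣ x n ∣ * ∣ y m - y n ∣
      ≤⟨ ℚ.+-mono-≤
           (ℚ.*-monoˡ-≤-nonNeg ∣ x m - x n ∣ {{ℚ.∣-∣-nonNeg (x m - x n)}}
             (ℚ.≤-trans (proj₂ (proj₂ (proj₂ by)) m Ny≤m) By≤B))
           (ℚ.*-monoʳ-≤-nonNeg ∣ y m - y n ∣ {{ℚ.∣-∣-nonNeg (y m - y n)}}
             (ℚ.≤-trans (proj₂ (proj₂ (proj₂ bx)) n Nx≤n) Bx≤B)) ⟩
    ∣ x m - x n ∣ * B + B * ∣ y m - y n ∣
      <⟨ ℚ.+-mono-<
           (ℚ.*-monoˡ-<-pos B (proj₂ (cx δ 0<δ) m n (Mx≤ N≤m) (Mx≤ N≤n)))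
           (ℚ.*-monoʳ-<-pos B (proj₂ (cy δ 0<δ) m n (My≤ N≤m) (My≤ N≤n))) ⟩
    δ * B + B * δ
      ≡⟨ δB+Bδ≡ε ⟩
    ε ∎
    where
    Ny≤m : Ny ℕ.≤ m
    Ny≤m = ℕ.m⊔n≤o⇒n≤o Nx Ny (ℕ.m⊔n≤o⇒m≤o (Nx ⊔ Ny) (Mx ⊔ My) N≤m)
    Nx≤n : Nx ℕ.≤ n
    Nx≤n = ℕ.m⊔n≤o⇒m≤o Nx Ny (ℕ.m⊔n≤o⇒m≤o (Nx ⊔ Ny) (Mx ⊔ My) N≤n)
    Mx≤ : ∀ {k} → N ℕ.≤ k → Mx ℕ.≤ k
    Mx≤ N≤k = ℕ.m⊔n≤o⇒m≤o Mx My (ℕ.m⊔n≤o⇒n≤o (Nx ⊔ Ny) (Mx ⊔ My) N≤k)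
    My≤ : ∀ {k} → N ℕ.≤ k → My ℕ.≤ k
    My≤ N≤k = ℕ.m⊔n≤o⇒n≤o Mx My (ℕ.m⊔n≤o⇒n≤o (Nx ⊔ Ny) (Mx ⊔ My) N≤k)

-- Cantor's reals.  Two Cauchy sequences represent the same real when each is
-- ≤ℝ the other; everything below respects that equivalence.
record ℝ : Set where
  constructor mkℝ
  field
    seq      : ℕ → ℚ
    isCauchy : IsCauchy seq

open ℝ public

infix  4 _<ℝ_ _≤ℝ_
infixl 7 _*ℝ_

_<ℝ_ : ℝ → ℝ → Set
x <ℝ y = ∃[ ε ] (0ℚ ℚ.< ε × ∃[ N ] (∀ n → N ℕ.≤ n → seq x n + ε ℚ.≤ seq y n))

_≤ℝ_ : ℝ → ℝ → Set
x ≤ℝ y = ¬ (y <ℝ x)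

_*ℝ_ : ℝ → ℝ → ℝ
x *ℝ y = mkℝ (λ n → seq x n * seq y n) (isCauchy-* (seq x) (seq y) (isCauchy x) (isCauchy y))

fromℤ : ℤ → ℝ
fromℤ z = mkℝ (λ _ → z ℚ./ 1) (isCauchy-const (z ℚ./ 1))

0ℝ 1ℝ : ℝ
0ℝ = fromℤ (+ 0)
1ℝ = fromℤ (+ 1)

-- The floor is given by its graph, z = ⌊ x ⌋, because it is not computable
-- as a function of a Cauchy sequence.
_IsFloorOf_ : ℤ → ℝ → Set
z IsFloorOf x = fromℤ z ≤ℝ x × x <ℝ fromℤ (z ℤ.+ 1ℤ)

𝒮 : ℝ → Pred ℕ 0ℓ
𝒮 t n = ∃[ k ] ((+ n) IsFloorOf (t *ℝ fromℤ (+ k)))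

𝒞 : Pred ℕ 0ℓ → Pred ℝ 0ℓ
𝒞 A t = 0ℝ <ℝ t × A ⊆ 𝒮 t

{-# OPTIONS --safe #-}

-- Suppose 𝒮 τ ⊆ 𝒮 t but τ < t.  As 1 ≤ τ, the integers ⌊τk⌋ are strictly
-- increasing in k, so writing ⌊τk⌋ = ⌊t jₖ⌋ gives strictly increasing indices,
-- whence k ≤ jₖ and tk ≤ t jₖ < ⌊τk⌋ + 1 ≤ τk + 1.  This fails once
-- k (t − τ) ≥ 1.  Floors exist only up to double negation, which suffices
-- because every inequality to be derived from them is between naturals.
module Submission where

open import Defs
open import Data.Empty using (⊥; ⊥-elim)
open import Data.Integer as ℤ using (+_; +≤+)
import Data.Integer.Properties as ℤ
open import Data.Nat as ℕ using (ℕ; zero; suc; z≤n; s≤s; _⊔_)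
open import Data.Nat.Coprimality as Coprimality using (1-coprimeTo)
import Data.Nat.Properties as ℕ
open import Data.Product using (∃-syntax; _×_; _,_; proj₁; proj₂)
open import Data.Rational as ℚ
  using (ℚ; mkℚ; 0ℚ; 1ℚ; ½; _+_; _*_; _-_; ∣_∣; 1/_; Positive; NonZero; positive; nonNegative; *≤*)
import Data.Rational.Properties as ℚ
open import Data.Rational.Solver using (module +-*-Solver)
open import Data.Sum using (inj₁; inj₂)
open import Function using (id)
open import Relation.Binary.PropositionalEquality
  using (_≡_; refl; sym; trans; cong; subst; subst₂)
open import Relation.Nullary using (¬_; yes; no)
open import Relation.Nullary.Decidable using (decidable-stable)
open import Relation.Unary using (_∈_)

open +-*-Solver

-- Order on the rationals.

ℚ-<⇒≱ : ∀ {p q} → p ℚ.< q → ¬ (q ℚ.≤ p)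
ℚ-<⇒≱ p<q q≤p = ℚ.<-irrefl refl (ℚ.<-≤-trans p<q q≤p)

p≤∣p∣ : ∀ p → p ℚ.≤ ∣ p ∣
p≤∣p∣ p with ℚ.≤-total 0ℚ p
... | inj₁ 0≤p = ℚ.≤-reflexive (sym (ℚ.0≤p⇒∣p∣≡p 0≤p))
... | inj₂ p≤0 = ℚ.≤-trans p≤0 (ℚ.0≤∣p∣ p)

-- Together with the ring solver these two replace linear arithmetic.
transfer-< : ∀ {l r} L R → l - r ≡ L - R → L ℚ.< R → l ℚ.< r
transfer-< {l} {r} L R eq L<R = subst₂ ℚ._<_ left (restore R r) (ℚ.+-monoˡ-< (r - R) L<R)
  where
  restore : ∀ a b → a + (b - a) ≡ b
  restore = solve 2 (λ a b → a :+ (b :- a) := b) refl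
  regroup : ∀ L R r → L + (r - R) ≡ (L - R) + r
  regroup = solve 3 (λ L R r → L :+ (r :- R) := (L :- R) :+ r) refl
  cancel : ∀ l r → (l - r) + r ≡ l
  cancel = solve 2 (λ l r → (l :- r) :+ r := l) refl
  left : L + (r - R) ≡ l
  left = trans (regroup L R r) (trans (cong (_+ r) (sym eq)) (cancel l r))

transfer-≤ : ∀ {l r} L R → l - r ≡ L - R → L ℚ.≤ R → l ℚ.≤ r
transfer-≤ {l} {r} L R eq L≤R =
  ℚ.≮⇒≥ λ r<l → ℚ-<⇒≱ (transfer-< r l (flip-eq L R l r eq) r<l) L≤R
  where
  neg : ∀ a b → a - b ≡ ℚ.- (b - a)
  neg = solve 2 (λ a b → a :- b := :- (b :- a)) refl
  flip-eq : ∀ L R l r → l - r ≡ L - R → R - L ≡ r - l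
  flip-eq L R l r eq = trans (neg R L) (trans (cong ℚ.-_ (sym eq)) (sym (neg r l)))

∣p-q∣<r⇒p<q+r : ∀ p q {r} → ∣ p - q ∣ ℚ.< r → p ℚ.< q + r
∣p-q∣<r⇒p<q+r p q {r} close =
  transfer-< (p - q) r (eq p q r) (ℚ.≤-<-trans (p≤∣p∣ (p - q)) close)
  where
  eq : ∀ p q r → p - (q + r) ≡ (p - q) - r
  eq = solve 3 (λ p q r → p :- (q :+ r) := (p :- q) :- r) refl

0<p*q : ∀ {p} q → .{{Positive q}} → 0ℚ ℚ.< p → 0ℚ ℚ.< p * q
0<p*q {p} q 0<p = ℚ.positive⁻¹ (p * q) {{ℚ.pos*pos⇒pos p {{positive 0<p}} q}}

-- Naturals inside the rationals and the Archimedean property.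

ι : ℕ → ℚ
ι n = (+ n) ℚ./ 1

-- The division in `ι n` normalises by a gcd that is stuck on a variable `n`; the explicit fraction
-- lets order and addition compute.
ι-mkℚ : ∀ n → ι n ≡ mkℚ (+ n) 0 (Coprimality.sym (1-coprimeTo n))
ι-mkℚ n = ℚ.↥p/↧p≡p (mkℚ (+ n) 0 (Coprimality.sym (1-coprimeTo n)))

ι-suc : ∀ n → ι (suc n) ≡ ι n + 1ℚ
ι-suc n = sym (trans (cong (_+ 1ℚ) (ι-mkℚ n))
  (cong (ℚ._/ 1) (trans (cong (ℤ._+ + 1) (ℤ.*-identityʳ (+ n))) (cong +_ (ℕ.+-comm n 1)))))

ι-+1 : ∀ n → ι (n ℕ.+ 1) ≡ ι n + 1ℚ
ι-+1 n = trans (cong ι (ℕ.+-comm n 1)) (ι-suc n)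

ι-mono-≤ : ∀ {m n} → m ℕ.≤ n → ι m ℚ.≤ ι n
ι-mono-≤ {m} {n} m≤n = subst₂ ℚ._≤_ (sym (ι-mkℚ m)) (sym (ι-mkℚ n))
  (*≤* (ℤ.*-monoʳ-≤-nonNeg (+ 1) (+≤+ m≤n)))

ι-cancel-< : ∀ {m n} → ι m ℚ.< ι n → m ℕ.< n
ι-cancel-< m<n = ℕ.≰⇒> λ n≤m → ℚ-<⇒≱ m<n (ι-mono-≤ n≤m)

0≤ι : ∀ n → 0ℚ ℚ.≤ ι n
0≤ι n = ι-mono-≤ {0} {n} z≤n

-- The denominator is at least 1, so a non-negative fraction is bounded by its numerator.
ℚ-archimedean : ∀ q → ∃[ n ] q ℚ.≤ ι n
ℚ-archimedean (mkℚ (+ n) d c) = n , subst (mkℚ (+ n) d c ℚ.≤_) (sym (ι-mkℚ n))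
  (*≤* (ℤ.*-monoˡ-≤-nonNeg (+ n) (+≤+ (s≤s z≤n))))
ℚ-archimedean (mkℚ ℤ.-[1+ n ] d c) = 0 , *≤* ℤ.-≤+

ℚ-archimedean-* : ∀ q → 0ℚ ℚ.< q → ∃[ n ] 1ℚ ℚ.≤ q * ι n
ℚ-archimedean-* q 0<q = n , subst (ℚ._≤ q * ι n) (ℚ.*-inverseʳ q)
  (ℚ.*-monoˡ-≤-nonNeg q {{ℚ.pos⇒nonNeg q}} (proj₂ bound))
  where
  instance
    q⁺ : Positive q
    q⁺ = positive 0<q
    q≢0 : NonZero q
    q≢0 = ℚ.pos⇒nonZero q
  bound = ℚ-archimedean (1/ q)
  n = proj₁ bound

-- Real inequalities as eventual inequalities of terms.

Eventually : (ℕ → Set) → Set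
Eventually P = ∃[ N ] (∀ n → N ℕ.≤ n → P n)

private
  variable
    P Q : ℕ → Set

ev-map : (∀ {n} → P n → Q n) → Eventually P → Eventually Q
ev-map f (N , p) = N , λ n N≤n → f (p n N≤n)

infixr 4 _∧ᵉ_
_∧ᵉ_ : Eventually P → Eventually Q → Eventually (λ n → P n × Q n)
(M , p) ∧ᵉ (N , q) = M ⊔ N , λ n le →
  p n (ℕ.m⊔n≤o⇒m≤o M N le) , q n (ℕ.m⊔n≤o⇒n≤o M N le)

ev-const : ∀ {A : Set} → Eventually (λ _ → A) → A
ev-const (N , a) = a N ℕ.≤-refl

-- Compare the two sequences once, at an index beyond which both vary by less
-- than h = ε/5: a gap of 3h there leaves a gap of h for ever after.
≤ℝ⇒eventually : ∀ x y → x ≤ℝ y → ∀ ε → 0ℚ ℚ.< ε →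
  Eventually (λ n → seq x n ℚ.< seq y n + ε)
≤ℝ⇒eventually x y x≤y ε 0<ε
  with isCauchy x (ε * (+ 1 ℚ./ 5)) (0<p*q (+ 1 ℚ./ 5) 0<ε)
     | isCauchy y (ε * (+ 1 ℚ./ 5)) (0<p*q (+ 1 ℚ./ 5) 0<ε)
... | Nx , closeX | Ny , closeY = N , below
  where
  h 3h : ℚ
  h = ε * (+ 1 ℚ./ 5)
  3h = h + h + h
  N = Nx ⊔ Ny
  Nx≤ : ∀ {n} → N ℕ.≤ n → Nx ℕ.≤ n
  Nx≤ = ℕ.m⊔n≤o⇒m≤o Nx Ny
  Ny≤ : ∀ {n} → N ℕ.≤ n → Ny ℕ.≤ n
  Ny≤ = ℕ.m⊔n≤o⇒n≤o Nx Ny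

  small : seq x N ℚ.< seq y N + 3h
  small with seq x N ℚ.<? seq y N + 3h
  ... | yes lt = lt
  ... | no ¬lt = ⊥-elim (x≤y (h , 0<p*q (+ 1 ℚ./ 5) 0<ε , N , λ n N≤n →
    let a = ∣p-q∣<r⇒p<q+r (seq x N) (seq x n) (closeX N n (Nx≤ ℕ.≤-refl) (Nx≤ N≤n))
        b = ∣p-q∣<r⇒p<q+r (seq y n) (seq y N) (closeY n N (Ny≤ N≤n) (Ny≤ ℕ.≤-refl))
    in ℚ.<⇒≤ (transfer-< _ _ (eq (seq x N) (seq y N) (seq x n) (seq y n) h)
         (ℚ.+-mono-≤-< (ℚ.≮⇒≥ ¬lt) (ℚ.+-mono-< a b)))))
    where
    eq : ∀ xN yN xn yn h → (yn + h) - xn ≡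
      ((yN + (h + h + h)) + (xN + yn)) - (xN + ((xn + h) + (yN + h)))
    eq = solve 5 (λ xN yN xn yn h → (yn :+ h) :- xn :=
      ((yN :+ (h :+ h :+ h)) :+ (xN :+ yn)) :- (xN :+ ((xn :+ h) :+ (yN :+ h)))) refl

  5h≡ε : h + h + h + (h + h) ≡ ε
  5h≡ε = trans (distrib ε (+ 1 ℚ./ 5)) (ℚ.*-identityʳ ε)
    where
    distrib : ∀ ε f → ε * f + ε * f + ε * f + (ε * f + ε * f) ≡ ε * (f + f + f + (f + f))
    distrib = solve 2 (λ ε f →
      ε :* f :+ ε :* f :+ ε :* f :+ (ε :* f :+ ε :* f) := ε :* (f :+ f :+ f :+ (f :+ f))) refl

  -- The 3h at index `N` and one variation h of each sequence add up to ε.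
  below : ∀ n → N ℕ.≤ n → seq x n ℚ.< seq y n + ε
  below n N≤n = subst (λ e → seq x n ℚ.< seq y n + e) 5h≡ε
    (transfer-< _ _ (eq (seq x N) (seq y N) (seq x n) (seq y n) h)
      (ℚ.+-mono-< small (ℚ.+-mono-<
        (∣p-q∣<r⇒p<q+r (seq x n) (seq x N) (closeX n N (Nx≤ N≤n) (Nx≤ ℕ.≤-refl)))
        (∣p-q∣<r⇒p<q+r (seq y N) (seq y n) (closeY N n (Ny≤ ℕ.≤-refl) (Ny≤ N≤n))))))
    where
    eq : ∀ xN yN xn yn h → xn - (yn + (h + h + h + (h + h))) ≡
      (xN + (xn + yN)) - ((yN + (h + h + h)) + ((xN + h) + (yn + h)))
    eq = solve 5 (λ xN yN xn yn h → xn :- (yn :+ (h :+ h :+ h :+ (h :+ h))) :=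
      (xN :+ (xn :+ yN)) :- ((yN :+ (h :+ h :+ h)) :+ ((xN :+ h) :+ (yn :+ h)))) refl

eventually⇒≤ℝ : ∀ x y → Eventually (λ n → seq x n ℚ.≤ seq y n) → x ≤ℝ y
eventually⇒≤ℝ x y ev (ε , 0<ε , y<x) =
  ev-const (ev-map contra (ev ∧ᵉ y<x))
  where
  contra : ∀ {n} → seq x n ℚ.≤ seq y n × seq y n + ε ℚ.≤ seq x n → ⊥
  contra {n} (xn≤yn , yn+ε≤xn) = ℚ-<⇒≱ 0<ε
    (transfer-≤ _ _ (eq (seq x n) (seq y n) ε) (ℚ.+-mono-≤ xn≤yn yn+ε≤xn))
    where
    eq : ∀ x y ε → ε - 0ℚ ≡ (x + (y + ε)) - (y + x)
    eq = solve 3 (λ x y ε → ε :- con 0ℚ := (x :+ (y :+ ε)) :- (y :+ x)) refl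

-- Multiplying inequalities by terms of `x` needs the terms themselves non-negative; `0ℝ ≤ℝ x` would
-- only keep them above every negative rational.
0<⇒eventually-0≤ : ∀ x → 0ℝ <ℝ x → Eventually (λ n → 0ℚ ℚ.≤ seq x n)
0<⇒eventually-0≤ x (ε , 0<ε , 0<x) =
  ev-map (ℚ.≤-trans (ℚ.≤-trans (ℚ.<⇒≤ 0<ε) (ℚ.≤-reflexive (sym (ℚ.+-identityˡ ε))))) 0<x

1≤⇒0< : ∀ x → 1ℝ ≤ℝ x → 0ℝ <ℝ x
1≤⇒0< x 1≤x = ½ , ℚ.positive⁻¹ ½ , ev-map half (≤ℝ⇒eventually 1ℝ x 1≤x ½ (ℚ.positive⁻¹ ½))
  where
  half : ∀ {n} → 1ℚ ℚ.< seq x n + ½ → 0ℚ + ½ ℚ.≤ seq x n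
  half {n} lt = ℚ.<⇒≤ (transfer-< _ _ (eq (seq x n)) lt)
    where
    eq : ∀ x → (0ℚ + ½) - x ≡ 1ℚ - (x + ½)
    eq = solve 1 (λ x → (con 0ℚ :+ con ½) :- x := con 1ℚ :- (x :+ con ½)) refl

-- Floors of non-negative reals, up to double negation.

ℝ-archimedean : ∀ x → ∃[ n ] x <ℝ fromℤ (+ n)
ℝ-archimedean x =
  let B , N , _ , bound = isCauchy⇒bounded (seq x) (isCauchy x)
      b , B≤b = ℚ-archimedean B
  -- Passing from `b` to `suc b` creates the gap 1 that `<ℝ` demands.
  in suc b , 1ℚ , ℚ.positive⁻¹ 1ℚ , N , λ n N≤n →
    subst (seq x n + 1ℚ ℚ.≤_) (sym (ι-suc b))
      (ℚ.+-monoˡ-≤ 1ℚ {seq x n} {ι b}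
        (ℚ.≤-trans (p≤∣p∣ (seq x n)) (ℚ.≤-trans (bound n N≤n) B≤b)))

-- Without a floor, `n ≤ x` forces `n + 1 ≤ x`, since `x < n + 1` would make `n` the floor. By
-- induction every natural is at most `x`, against the Archimedean property.
¬¬-floor : ∀ x → 0ℝ ≤ℝ x → ¬ ¬ (∃[ n ] (+ n) IsFloorOf x)
¬¬-floor x 0≤x no-floor = lower (proj₁ above) (proj₂ above)
  where
  above = ℝ-archimedean x
  lower : ∀ n → fromℤ (+ n) ≤ℝ x
  lower zero = 0≤x
  lower (suc n) x<1+n =
    no-floor (n , lower n , subst (λ m → x <ℝ fromℤ (+ m)) (ℕ.+-comm 1 n) x<1+n)

0≤*ι : ∀ x → 0ℝ <ℝ x → ∀ k → 0ℝ ≤ℝ x *ℝ fromℤ (+ k)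
0≤*ι x 0<x k = eventually⇒≤ℝ 0ℝ (x *ℝ fromℤ (+ k)) (ev-map scale (0<⇒eventually-0≤ x 0<x))
  where
  scale : ∀ {n} → 0ℚ ℚ.≤ seq x n → 0ℚ ℚ.≤ seq x n * ι k
  scale {n} 0≤xn = subst (ℚ._≤ seq x n * ι k) (ℚ.*-zeroˡ (ι k))
    (ℚ.*-monoʳ-≤-nonNeg (ι k) {{nonNegative (0≤ι k)}} 0≤xn)

-- Floors of multiples of a real.

-- `m + 1 ≤ τk + τ = τ(k + 1) < n + 1`.
floor-step : ∀ τ → 1ℝ ≤ℝ τ → ∀ k m n →
  (+ m) IsFloorOf (τ *ℝ fromℤ (+ k)) →
  (+ n) IsFloorOf (τ *ℝ fromℤ (+ suc k)) → m ℕ.< n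
floor-step τ 1≤τ k m n (m≤τk , _) (_ , δ , 0<δ , τk+τ<n+1) =
  ι-cancel-< (ev-const (ev-map combine
    -- The gap `δ` below `n + 1` is split in half to pay for the errors in the two weak
    -- inequalities.
    (≤ℝ⇒eventually (fromℤ (+ m)) (τ *ℝ fromℤ (+ k)) m≤τk (δ * ½) (0<p*q ½ 0<δ)
     ∧ᵉ ≤ℝ⇒eventually 1ℝ τ 1≤τ (δ * ½) (0<p*q ½ 0<δ)
     ∧ᵉ τk+τ<n+1)))
  where
  eq : ∀ m n τ k δ → m - n ≡
    ((m + 1ℚ) + (τ * (k + 1ℚ) + δ)) - (((τ * k + δ * ½) + (τ + δ * ½)) + (n + 1ℚ))
  eq = solve 5 (λ m n τ k δ → m :- n :=
    ((m :+ con 1ℚ) :+ (τ :* (k :+ con 1ℚ) :+ δ)) :-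
    (((τ :* k :+ δ :* con ½) :+ (τ :+ δ :* con ½)) :+ (n :+ con 1ℚ))) refl
  arith : ∀ m n τ k δ → m ℚ.< τ * k + δ * ½ → 1ℚ ℚ.< τ + δ * ½ →
    τ * (k + 1ℚ) + δ ℚ.≤ n + 1ℚ → m ℚ.< n
  arith m n τ k δ a b c =
    transfer-< _ _ (eq m n τ k δ) (ℚ.+-mono-<-≤ (ℚ.+-mono-< a b) c)
  combine : ∀ {i} → ι m ℚ.< seq τ i * ι k + δ * ½ × 1ℚ ℚ.< seq τ i + δ * ½
    × seq τ i * ι (suc k) + δ ℚ.≤ ι (n ℕ.+ 1) → ι m ℚ.< ι n
  combine {i} (a , b , c) = arith (ι m) (ι n) (seq τ i) (ι k) δ a b
    (subst₂ (λ u v → seq τ i * u + δ ℚ.≤ v) (ι-suc k) (ι-+1 n) c)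

-- `m ≤ tj ≤ tk < n + 1`, where the gap `δ` of the last inequality absorbs the error of the first.
floor-mono : ∀ t → 0ℝ <ℝ t → ∀ {j k} m n → j ℕ.≤ k →
  (+ m) IsFloorOf (t *ℝ fromℤ (+ j)) →
  (+ n) IsFloorOf (t *ℝ fromℤ (+ k)) → m ℕ.≤ n
floor-mono t 0<t {j} {k} m n j≤k (m≤tj , _) (_ , δ , 0<δ , tk<n+1) =
  ℕ.m<1+n⇒m≤n (ι-cancel-< (ev-const (ev-map combine
    (≤ℝ⇒eventually (fromℤ (+ m)) (t *ℝ fromℤ (+ j)) m≤tj δ 0<δ
     ∧ᵉ 0<⇒eventually-0≤ t 0<t ∧ᵉ tk<n+1))))
  where
  combine : ∀ {i} → ι m ℚ.< seq t i * ι j + δ × 0ℚ ℚ.≤ seq t i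
    × seq t i * ι k + δ ℚ.≤ ι (n ℕ.+ 1) → ι m ℚ.< ι (suc n)
  combine {i} (a , 0≤t , b) = ℚ.<-≤-trans a (ℚ.≤-trans
    (ℚ.+-monoˡ-≤ δ (ℚ.*-monoˡ-≤-nonNeg (seq t i) {{nonNegative 0≤t}} (ι-mono-≤ j≤k)))
    (subst (λ l → seq t i * ι k + δ ℚ.≤ ι l) (ℕ.+-comm n 1) b))

-- Comparison of indices and maximality of `τ`.

-- Induction on `k`. If `j ≤ k` at stage `k + 1`, the floor `m` of `τk` is also the floor of some
-- `ti`, with `k ≤ i` by induction. Then `j ≤ i` gives `n ≤ m`, whereas `floor-step` gives `m < n`.
index-≤ : ∀ τ t → 1ℝ ≤ℝ τ → t ∈ 𝒞 (𝒮 τ) → ∀ k n j →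
  (+ n) IsFloorOf (τ *ℝ fromℤ (+ k)) →
  (+ n) IsFloorOf (t *ℝ fromℤ (+ j)) → k ℕ.≤ j
index-≤ τ t 1≤τ t∈𝒞 zero _ _ _ _ = z≤n
index-≤ τ t 1≤τ t∈𝒞@(0<t , sub) (suc k) n j n-floor-τ n-floor-t =
  -- Order on naturals is decidable, so it suffices to refute the negation, and for that goal a
  -- doubly negated floor may be unpacked.
  decidable-stable (suc k ℕ.≤? j) λ k≮j →
    ¬¬-floor (τ *ℝ fromℤ (+ k)) (0≤*ι τ (1≤⇒0< τ 1≤τ) k) λ (m , m-floor-τ) →
      let i , m-floor-t = sub {m} (k , m-floor-τ)
          k≤i = index-≤ τ t 1≤τ t∈𝒞 k m i m-floor-τ m-floor-t
          j≤i = ℕ.≤-trans (ℕ.≮⇒≥ k≮j) k≤i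
      in ℕ.<⇒≱ (floor-step τ 1≤τ k m n m-floor-τ n-floor-τ)
               (floor-mono t 0<t n m j≤i n-floor-t m-floor-t)

-- `τk + ηk ≤ tk ≤ tj < n + 1 ≤ τk + 1` would give `ηk < 1`. Here `η` is the gap carried by
-- `τ <ℝ t`, bound in the type so that the size of `k` can refer to it.
no-common-floor : ∀ τ t → 0ℝ <ℝ t → ((η , _) : τ <ℝ t) → ∀ {k j} n →
  1ℚ ℚ.≤ η * ι k → k ℕ.≤ j →
  (+ n) IsFloorOf (τ *ℝ fromℤ (+ k)) →
  (+ n) IsFloorOf (t *ℝ fromℤ (+ j)) → ⊥
no-common-floor τ t 0<t (η , 0<η , τ<t) {k} {j} n 1≤ηk k≤j (n≤τk , _) (_ , δ , 0<δ , tj<n+1) =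
  ev-const (ev-map combine
    (≤ℝ⇒eventually (fromℤ (+ n)) (τ *ℝ fromℤ (+ k)) n≤τk δ 0<δ
     ∧ᵉ 0<⇒eventually-0≤ t 0<t ∧ᵉ τ<t ∧ᵉ tj<n+1))
  where
  eq : ∀ n τ δ η t k tj → η * k - 1ℚ ≡
    (n + ((τ + η) * k + (t * k + (tj + δ)))) - ((τ * k + δ) + (t * k + (tj + (n + 1ℚ))))
  eq = solve 7 (λ n τ δ η t k tj → η :* k :- con 1ℚ :=
    (n :+ ((τ :+ η) :* k :+ (t :* k :+ (tj :+ δ)))) :-
    ((τ :* k :+ δ) :+ (t :* k :+ (tj :+ (n :+ con 1ℚ))))) refl
  arith : ∀ n τ t k tj → n ℚ.< τ * k + δ → (τ + η) * k ℚ.≤ t * k →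
    t * k ℚ.≤ tj → tj + δ ℚ.≤ n + 1ℚ → η * k ℚ.< 1ℚ
  arith n τ t k tj a b c d = transfer-< _ _ (eq n τ δ η t k tj)
    (ℚ.+-mono-<-≤ a (ℚ.+-mono-≤ b (ℚ.+-mono-≤ c d)))
  combine : ∀ {i} → ι n ℚ.< seq τ i * ι k + δ × 0ℚ ℚ.≤ seq t i
    × seq τ i + η ℚ.≤ seq t i × seq t i * ι j + δ ℚ.≤ ι (n ℕ.+ 1) → ⊥
  combine {i} (a , 0≤t , b , c) = ℚ-<⇒≱
    (arith (ι n) (seq τ i) (seq t i) (ι k) (seq t i * ι j) a
      (ℚ.*-monoʳ-≤-nonNeg (ι k) {{nonNegative (0≤ι k)}} b)
      (ℚ.*-monoˡ-≤-nonNeg (seq t i) {{nonNegative 0≤t}} (ι-mono-≤ k≤j))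
      (subst (seq t i * ι j + δ ℚ.≤_) (ι-+1 n) c))
    1≤ηk

proposition2 : (τ : ℝ) → 1ℝ ≤ℝ τ →
    (τ ∈ 𝒞 (𝒮 τ)) × ((t : ℝ) → t ∈ 𝒞 (𝒮 τ) → t ≤ℝ τ)
-- The goal `t ≤ℝ τ` is itself a negation: the witness of `τ <ℝ t` supplies `η`, and the resulting
-- goal is empty, so `¬¬-floor` applies.
proposition2 τ 1≤τ = (1≤⇒0< τ 1≤τ , id) , λ t t∈𝒞@(0<t , sub) τ<t@(η , 0<η , _) →
  let k , 1≤ηk = ℚ-archimedean-* η 0<η
  in ¬¬-floor (τ *ℝ fromℤ (+ k)) (0≤*ι τ (1≤⇒0< τ 1≤τ) k) λ (n , n-floor-τ) →
    let j , n-floor-t = sub {n} (k , n-floor-τ)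
        k≤j = index-≤ τ t 1≤τ t∈𝒞 k n j n-floor-τ n-floor-t
    in no-common-floor τ t 0<t τ<t n 1≤ηk k≤j n-floor-τ n-floor-t
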